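{- Let $b\ge 2$ and $n\ge 0$ be integers. Then $$g(T_b(n)) = \frac{(b^{3}+b^{2}-b-1)\,b^{2n} + \{(n-1)(b^{2}-1)-2\}\,b^{n} - 2b + 4}{2}.$$
   Context: For integers $b\ge 2$, $n\ge 0$ and $i\ge 0$ put $s_i=(b+1)b^{n+i}-1$, and let $T_b(n)=\langle\{s_i : i\in\mathbb{N}\}\rangle$ be the submonoid of $(\mathbb{N},+)$ generated by these numbers (a numerical semigroup). For a numerical semigroup $S$, the genus $g(S)$ is the cardinality of $\mathbb{N}\setminus S$. -}

module Defs where

open import Data.List using (List; length)
open import Data.List.Membership.Propositional using () renaming (_∈_ to _∈ₗ_)
open import Data.List.Relation.Unary.Unique.Propositional using (Unique)
open import Data.Nat using (ℕ; _+_; _*_; _∸_; _^_)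
open import Data.Product using (_×_; ∃-syntax)
open import Function.Bundles using (_⇔_)
open import Level using (0ℓ)
open import Relation.Binary.PropositionalEquality using (_≡_)
open import Relation.Unary using (Pred; _∈_; ∁)

data ⟨_⟩ (G : Pred ℕ 0ℓ) : Pred ℕ 0ℓ where
  gen  : ∀ {x} → x ∈ G → x ∈ ⟨ G ⟩
  zero : 0 ∈ ⟨ G ⟩
  add  : ∀ {x y} → x ∈ ⟨ G ⟩ → y ∈ ⟨ G ⟩ → x + y ∈ ⟨ G ⟩

-- The truncated subtraction is exact whenever b ≥ 1.
s : (b n i : ℕ) → ℕ
s b n i = (b + 1) * b ^ (n + i) ∸ 1

T : (b n : ℕ) → Pred ℕ 0ℓ
T b n = ⟨ (λ x → ∃[ i ] x ≡ s b n i) ⟩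

-- The set P is finite with exactly k elements: it is enumerated without
-- repetition by a list of length k.
HasCardinality : Pred ℕ 0ℓ → ℕ → Set
HasCardinality P k =
  ∃[ xs ] Unique xs × length xs ≡ k × (∀ x → x ∈ₗ xs ⇔ x ∈ P)

-- The genus is a relation, not a function, since ℕ ∖ S is not known in advance
-- to be finite.
HasGenus : Pred ℕ 0ℓ → ℕ → Set
HasGenus S g = HasCardinality (∁ S) g

{-# OPTIONS --safe #-}
module Submission where

-- Put d = b − 1, m = s₀ and v(N) = Σ_{i≥1} ⌊N / bⁱ⌋.  Since bⁱ = 1 + d v(bⁱ), the
-- generator sᵢ equals m bⁱ + d v(bⁱ), and T b n turns out to be the set of all
-- m N + d j with j ≤ v(N).  As m = d q + 1 is coprime to d, every natural number outside
-- ⟨m, d⟩ is r + k d with r < d and k < r q, and every element of ⟨m, d⟩ is uniquely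
-- m N + d j with j < m; the latter is a gap of T b n exactly when v(N) < j.  Because
-- v(N₀) = m − 1 at N₀ = bⁿ(b² − 1), the genus is
--   Σ_{r<d} r q + Σ_{N<N₀} (m − 1 − v(N)),
-- and Σ_{N<N₀} v(N) follows from the recursion v(b N + r) = N + v(N) for r < b.

open import Defs

module NumericalSemigroup where

  open import Data.List using (applyUpTo; _++_)
  open import Data.List.Properties using (length-applyUpTo; length-++)
  open import Data.List.Membership.Propositional.Properties
    using (∈-applyUpTo⁺; ∈-applyUpTo⁻; ∈-++⁺ˡ; ∈-++⁺ʳ; ∈-++⁻)
  import Data.List.Relation.Unary.Unique.Propositional.Properties as Unique
  open import Data.Nat
  open import Data.Nat.Coprimality using (Coprime; coprime-divisor)
  open import Data.Nat.DivMod
  open import Data.Nat.Divisibility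
  open import Data.Nat.Properties
  open import Data.Nat.Tactic.RingSolver using (solve-∀)
  open import Data.Product using (_×_; _,_; ∃-syntax; proj₁; proj₂)
  open import Data.Sum using (inj₁; inj₂; [_,_])
  open import Function using (_∘_)
  open import Function.Bundles using (_⇔_; mk⇔; Equivalence)
  open import Level using (0ℓ)
  open import Relation.Binary.PropositionalEquality
    using (_≡_; refl; sym; trans; cong; cong₂; subst; module ≡-Reasoning)
  open import Relation.Nullary using (¬_; yes; no; contradiction)
  open import Relation.Unary using (Pred; _∪_; _∈_; _∉_)

  -- Finite sums

  Σ< : ℕ → (ℕ → ℕ) → ℕ
  Σ< zero    f = 0
  Σ< (suc n) f = f n + Σ< n f

  +-interchange : ∀ k l m n → (k + l) + (m + n) ≡ (k + m) + (l + n)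
  +-interchange = solve-∀

  Σ<-cong : ∀ n {f g : ℕ → ℕ} → (∀ {i} → i < n → f i ≡ g i) → Σ< n f ≡ Σ< n g
  Σ<-cong zero    f≗g = refl
  Σ<-cong (suc n) f≗g = cong₂ _+_ (f≗g ≤-refl) (Σ<-cong n (f≗g ∘ m≤n⇒m≤1+n))

  Σ<-+ : ∀ n (f g : ℕ → ℕ) → Σ< n (λ i → f i + g i) ≡ Σ< n f + Σ< n g
  Σ<-+ zero    f g = refl
  Σ<-+ (suc n) f g = trans (cong (f n + g n +_) (Σ<-+ n f g)) (+-interchange (f n) (g n) _ _)

  Σ<-const : ∀ n c → Σ< n (λ _ → c) ≡ n * c
  Σ<-const zero    c = refl
  Σ<-const (suc n) c = cong (c +_) (Σ<-const n c)

  Σ<-split : ∀ k n (f : ℕ → ℕ) → Σ< (n + k) f ≡ Σ< k (λ i → f (n + i)) + Σ< n f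
  Σ<-split zero    n f = cong (λ z → Σ< z f) (+-identityʳ n)
  Σ<-split (suc k) n f = begin
    Σ< (n + suc k) f                                   ≡⟨ cong (λ z → Σ< z f) (+-suc n k) ⟩
    f (n + k) + Σ< (n + k) f                           ≡⟨ cong (f (n + k) +_) (Σ<-split k n f) ⟩
    f (n + k) + (Σ< k (λ i → f (n + i)) + Σ< n f)      ≡⟨ +-assoc (f (n + k)) _ _ ⟨
    f (n + k) + Σ< k (λ i → f (n + i)) + Σ< n f        ∎
    where open ≡-Reasoning

  -- Gauss's sum, doubled and with the subtracted term on the left so that it stays in ℕ. At
  -- `n = d`, `c = q` it counts the gaps of `⟨m, d⟩`.
  Σ<-linear : ∀ n c → 2 * Σ< n (_* c) + n * c ≡ n * n * c
  Σ<-linear zero    c = refl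
  Σ<-linear (suc n) c = begin
    2 * (n * c + Σ< n (_* c)) + suc n * c          ≡⟨ isolate n c (Σ< n (_* c)) ⟩
    (2 * Σ< n (_* c) + n * c) + (2 * n + 1) * c    ≡⟨ cong (_+ (2 * n + 1) * c) (Σ<-linear n c) ⟩
    n * n * c + (2 * n + 1) * c                    ≡⟨ square n c ⟩
    suc n * suc n * c                              ∎
    where
    open ≡-Reasoning
    isolate : ∀ n c s → 2 * (n * c + s) + suc n * c ≡ (2 * s + n * c) + (2 * n + 1) * c
    isolate = solve-∀
    square : ∀ n c → n * n * c + (2 * n + 1) * c ≡ suc n * suc n * c
    square = solve-∀

  Σ<-id : ∀ n → 2 * Σ< n (λ i → i) + n ≡ n * n
  Σ<-id n = begin
    2 * Σ< n (λ i → i) + n          ≡⟨ cong₂ (λ x y → 2 * x + y)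
                                         (Σ<-cong n (λ {i} _ → sym (*-identityʳ i))) (sym (*-identityʳ n)) ⟩
    2 * Σ< n (_* 1) + n * 1         ≡⟨ Σ<-linear n 1 ⟩
    n * n * 1                       ≡⟨ *-identityʳ (n * n) ⟩
    n * n                           ∎
    where open ≡-Reasoning

  -- Cardinality

  HasCardinality-resp : ∀ {P Q : Pred ℕ 0ℓ} {k} → (∀ x → x ∈ P ⇔ x ∈ Q) →
                        HasCardinality P k → HasCardinality Q k
  HasCardinality-resp P⇔Q (xs , uniq , len , mem) =
    xs , uniq , len , λ x → mk⇔
      (Equivalence.to (P⇔Q x) ∘ Equivalence.to (mem x))
      (Equivalence.from (mem x) ∘ Equivalence.from (P⇔Q x))

  HasCardinality-∪ : ∀ {P Q : Pred ℕ 0ℓ} {k l} → (∀ {x} → x ∈ P → x ∉ Q) →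
                     HasCardinality P k → HasCardinality Q l →
                     HasCardinality (P ∪ Q) (k + l)
  HasCardinality-∪ disj (xs , uxs , refl , memP) (ys , uys , refl , memQ) =
    xs ++ ys ,
    Unique.++⁺ uxs uys (λ { (x∈xs , x∈ys) →
      disj (Equivalence.to (memP _) x∈xs) (Equivalence.to (memQ _) x∈ys) }) ,
    length-++ xs ,
    λ x → mk⇔
      ([ inj₁ ∘ Equivalence.to (memP x) , inj₂ ∘ Equivalence.to (memQ x) ] ∘ ∈-++⁻ xs)
      [ ∈-++⁺ˡ ∘ Equivalence.from (memP x) , ∈-++⁺ʳ xs ∘ Equivalence.from (memQ x) ]

  HasCardinality-image : ∀ (f : ℕ → ℕ) n →
    (∀ {i j} → i < n → j < n → f i ≡ f j → i ≡ j) →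
    HasCardinality (λ x → ∃[ i ] i < n × x ≡ f i) n
  HasCardinality-image f n inj =
    applyUpTo f n ,
    Unique.applyUpTo⁺₁ f n (λ i<j j<n → <⇒≢ i<j ∘ inj (<-trans i<j j<n) j<n) ,
    length-applyUpTo f n ,
    λ x → mk⇔ (∈-applyUpTo⁻ f) (λ { (i , i<n , refl) → ∈-applyUpTo⁺ f i<n })

  -- Both families of gaps have this shape: lattice points under the graph of `c`, coded as numbers
  -- by `f`.
  DoubleImage : (ℕ → ℕ → ℕ) → (ℕ → ℕ) → ℕ → Pred ℕ 0ℓ
  DoubleImage f c n x = ∃[ i ] ∃[ j ] i < n × j < c i × x ≡ f i j

  -- Induction on the columns: column `n` is an injective image of `c n` indices, and joint
  -- injectivity of `f` keeps it disjoint from the earlier ones.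
  HasCardinality-DoubleImage : ∀ (f : ℕ → ℕ → ℕ) (c : ℕ → ℕ) n →
    (∀ {i j i′ j′} → i < n → i′ < n → j < c i → j′ < c i′ →
      f i j ≡ f i′ j′ → i ≡ i′ × j ≡ j′) →
    HasCardinality (DoubleImage f c n) (Σ< n c)
  HasCardinality-DoubleImage f c zero inj =
    HasCardinality-resp (λ x → mk⇔ (λ { (_ , () , _) }) (λ { (_ , _ , () , _) }))
      (HasCardinality-image (λ i → i) 0 (λ ()))
  HasCardinality-DoubleImage f c (suc n) inj =
    HasCardinality-resp split
      (HasCardinality-∪ disjoint
        (HasCardinality-image (f n) (c n)
          (λ j<c j′<c eq → proj₂ (inj ≤-refl ≤-refl j<c j′<c eq)))
        (HasCardinality-DoubleImage f c n
          (λ i<n i′<n → inj (m≤n⇒m≤1+n i<n) (m≤n⇒m≤1+n i′<n))))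
    where
    disjoint : ∀ {x} → (∃[ j ] j < c n × x ≡ f n j) → x ∉ DoubleImage f c n
    disjoint (j , j<c , refl) (i′ , j′ , i′<n , j′<c , eq) =
      <⇒≢ i′<n (sym (proj₁ (inj ≤-refl (m≤n⇒m≤1+n i′<n) j<c j′<c eq)))

    split : ∀ x → x ∈ ((λ x → ∃[ j ] j < c n × x ≡ f n j) ∪ DoubleImage f c n) ⇔
                  x ∈ DoubleImage f c (suc n)
    split x = mk⇔ to from
      where
      to : _ → _
      to (inj₁ (j , j<c , eq))           = n , j , ≤-refl , j<c , eq
      to (inj₂ (i , j , i<n , j<c , eq)) = i , j , m≤n⇒m≤1+n i<n , j<c , eq
      from : _ → _
      from (i , j , i<1+n , j<c , eq) with m<1+n⇒m<n∨m≡n i<1+n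
      ... | inj₁ i<n  = inj₂ (i , j , i<n , j<c , eq)
      ... | inj₂ refl = inj₁ (j , j<c , eq)

  -- Gaps

  module Gaps (d q : ℕ) .{{_ : NonZero d}} where

    m : ℕ
    m = suc (d * q)

    m-coprime-d : Coprime m d
    m-coprime-d {k} (k∣m , k∣d) =
      ∣1⇒≡1 (∣m+n∣m⇒∣n (subst (k ∣_) (+-comm 1 (d * q)) k∣m) (∣-trans k∣d (m∣m*n q)))

    -- If `N′` were `N + 1 + c`, then `d (j − j′) = m (1 + c)`, and coprimality would make `m`
    -- divide the positive number `j − j′ ≤ j`, against `j < m`. So a representation with `j < m`
    -- has the largest coefficient of `m`.
    quotient-maximal : ∀ {N j N′ j′} → j < m → m * N + d * j ≡ m * N′ + d * j′ → N′ ≤ N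
    quotient-maximal {N} {j} {N′} {j′} j<m eq with N′ ≤? N
    ... | yes N′≤N = N′≤N
    ... | no  N′≰N with m≤n⇒∃[o]m+o≡n (≰⇒> N′≰N)
    ...   | c , refl = contradiction j<m (≤⇒≯ m≤j)
      where
      shifted : d * j ≡ m * suc c + d * j′
      shifted = +-cancelˡ-≡ (m * N) _ _ (trans eq (rearrange m N c (d * j′)))
        where
        rearrange : ∀ m N c x → m * (suc N + c) + x ≡ m * N + (m * suc c + x)
        rearrange = solve-∀

      j′≤j : j′ ≤ j
      j′≤j = *-cancelˡ-≤ d (subst (d * j′ ≤_) (sym shifted) (m≤n+m (d * j′) (m * suc c)))

      difference : d * (j ∸ j′) ≡ m * suc c
      difference = +-cancelʳ-≡ (d * j′) _ _ (begin
        d * (j ∸ j′) + d * j′  ≡⟨ *-distribˡ-+ d (j ∸ j′) j′ ⟨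
        d * (j ∸ j′ + j′)      ≡⟨ cong (d *_) (m∸n+n≡m j′≤j) ⟩
        d * j                  ≡⟨ shifted ⟩
        m * suc c + d * j′     ∎)
        where open ≡-Reasoning

      m≤j : m ≤ j
      m≤j with j ∸ j′ in e
      ... | zero  = contradiction
                      (trans (sym difference) (trans (cong (d *_) e) (*-zeroʳ d))) λ ()
      ... | suc k = begin
        m       ≤⟨ ∣⇒≤ (coprime-divisor m-coprime-d
                     (divides (suc c) (trans (cong (d *_) (sym e)) (trans difference (*-comm m (suc c)))))) ⟩
        suc k   ≡⟨ e ⟨
        j ∸ j′  ≤⟨ m∸n≤m j j′ ⟩
        j       ∎
        where open ≤-Reasoning

    -- Since m ≡ 1, both sides are N modulo d, so N ≥ r.
    remainder-bound : ∀ {N j r k} → r < d → r + k * d ≡ m * N + d * j → r * q ≤ k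
    remainder-bound {N} {j} {r} {k} r<d eq = *-cancelʳ-≤ (r * q) k d (+-cancelˡ-≤ r _ _ (begin
      r + r * q * d            ≤⟨ +-mono-≤ r≤N (*-monoˡ-≤ d (*-monoˡ-≤ q r≤N)) ⟩
      N + N * q * d            ≤⟨ m≤m+n _ (d * j) ⟩
      N + N * q * d + d * j    ≡⟨ expand N q d j ⟨
      m * N + d * j            ≡⟨ eq ⟨
      r + k * d                ∎))
      where
      open ≤-Reasoning
      expand : ∀ N q d j → suc (d * q) * N + d * j ≡ N + N * q * d + d * j
      expand = solve-∀
      factor : ∀ N q d j → suc (d * q) * N + d * j ≡ N + (q * N + j) * d
      factor = solve-∀
      r≤N : r ≤ N
      r≤N = begin
        r                              ≡⟨ m<n⇒m%n≡m r<d ⟨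
        r % d                          ≡⟨ [m+kn]%n≡m%n r k d ⟨
        (r + k * d) % d                ≡⟨ cong (_% d) (trans eq (factor N q d j)) ⟩
        (N + (q * N + j) * d) % d      ≡⟨ [m+kn]%n≡m%n N (q * N + j) d ⟩
        N % d                          ≤⟨ m%n≤m N d ⟩
        N                              ∎

    Staircase : (ℕ → ℕ) → Pred ℕ 0ℓ
    Staircase v x = ∃[ N ] ∃[ j ] x ≡ m * N + d * j × j ≤ v N

    module _ (v : ℕ → ℕ) (v-mono : ∀ {M N} → M ≤ N → v M ≤ v N)
             (N₀ : ℕ) (v[N₀] : v N₀ ≡ d * q) where

      private
        -- The gaps of ⟨ m , d ⟩.
        low : ℕ → ℕ → ℕ
        low r k = r + k * d

        -- The index `i` runs through the second coefficients above `v N`; those below `m` are the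
        -- ones with `i < d * q ∸ v N`.
        high : ℕ → ℕ → ℕ
        high N i = m * N + d * (suc (v N) + i)

        Low High : Pred ℕ 0ℓ
        Low  = DoubleImage low (_* q) d
        High = DoubleImage high (λ N → d * q ∸ v N) N₀

        low-injective : ∀ {r k r′ k′} → r < d → r′ < d → low r k ≡ low r′ k′ → r ≡ r′ × k ≡ k′
        low-injective {r} {k} {r′} {k′} r<d r′<d eq with r≡r′
          where
          r≡r′ : r ≡ r′
          r≡r′ = begin
            r                  ≡⟨ m<n⇒m%n≡m r<d ⟨
            r % d              ≡⟨ [m+kn]%n≡m%n r k d ⟨
            (r + k * d) % d    ≡⟨ cong (_% d) eq ⟩
            (r′ + k′ * d) % d  ≡⟨ [m+kn]%n≡m%n r′ k′ d ⟩
            r′ % d             ≡⟨ m<n⇒m%n≡m r′<d ⟩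
            r′                 ∎
            where open ≡-Reasoning
        ... | refl = refl , *-cancelʳ-≡ k k′ d (+-cancelˡ-≡ r _ _ eq)

        v+i<m : ∀ N {i} → i < d * q ∸ v N → suc (v N) + i < m
        v+i<m N {i} i< = s≤s (begin-strict
          v N + i              <⟨ +-monoʳ-< (v N) i< ⟩
          -- A nonempty range for `i` forces `v N < d * q`, so the truncated subtraction is exact.
          v N + (d * q ∸ v N)  ≡⟨ m+[n∸m]≡n {v N} (<⇒≤ (m∸n≢0⇒n<m (m<n⇒n≢0 i<))) ⟩
          d * q                ∎)
          where open ≤-Reasoning

        -- Both second coefficients are below `m`, so `quotient-maximal` applies in both directions
        -- and gives `N ≡ N′`.
        high-injective : ∀ {N i N′ i′} → i < d * q ∸ v N → i′ < d * q ∸ v N′ →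
                         high N i ≡ high N′ i′ → N ≡ N′ × i ≡ i′
        high-injective {N} {i} {N′} {i′} i< i′< eq
          with ≤-antisym (quotient-maximal (v+i<m N′ i′<) (sym eq)) (quotient-maximal (v+i<m N i<) eq)
        ... | refl = refl , +-cancelˡ-≡ (suc (v N)) _ _
                              (*-cancelˡ-≡ _ _ d (+-cancelˡ-≡ (m * N) _ _ eq))

        -- Excluding every `j`, and not only `j ≤ v N`, makes this also separate `Low` from `High`.
        low-gap : ∀ {x} → x ∈ Low → ¬ (∃[ N ] ∃[ j ] x ≡ m * N + d * j)
        low-gap (r , k , r<d , k<rq , refl) (N , j , eq) =
          contradiction (remainder-bound r<d eq) (<⇒≱ k<rq)

        -- A competing representation has `N′ ≤ N`, hence `j′ ≤ v N′ ≤ v N`; its value is then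
        -- strictly smaller than `high N i`.
        high-gap : ∀ {x} → x ∈ High → x ∉ Staircase v
        high-gap (N , i , N<N₀ , i< , refl) (N′ , j′ , eq , j′≤) =
          <⇒≢ (+-mono-≤-< (*-monoʳ-≤ m N′≤N) (*-monoʳ-< d j′<)) (sym eq)
          where
          N′≤N : N′ ≤ N
          N′≤N = quotient-maximal (v+i<m N i<) eq
          j′< : j′ < suc (v N) + i
          j′< = s≤s (≤-trans j′≤ (≤-trans (v-mono N′≤N) (m≤m+n (v N) i)))

        -- Write `x = r + k d`. If `k ≥ r q`, then `r q` copies of `d` turn `r` into `r m`, and
        -- dividing the excess by `m` leaves some `j < m`; now `x∉` forces `v N < j`.
        gap-cases : ∀ {x} → x ∉ Staircase v → x ∈ (Low ∪ High)
        gap-cases {x} x∉ with x / d <? x % d * q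
        ... | yes k<rq = inj₁ (x % d , x / d , m%n<n x d , k<rq , m≡m%n+[m/n]*n x d)
        ... | no  k≮rq = inj₂ (N , j ∸ suc (v N) , N<N₀ , i< ,
            trans x≡ (cong (λ z → m * N + d * z) (sym (m+[n∸m]≡n v<j))))
          where
          r k l t j N : ℕ
          r = x % d
          k = x / d
          l = k ∸ r * q
          t = l / m
          j = l % m
          -- The `t * m` copies of `d` split off by the division are `d * t` copies of `m`.
          N = r + d * t

          assemble : ∀ r t j d q → r + (r * q + (j + t * suc (d * q))) * d
                                   ≡ suc (d * q) * (r + d * t) + d * j
          assemble = solve-∀

          x≡ : x ≡ m * N + d * j
          x≡ = begin
            x                                ≡⟨ m≡m%n+[m/n]*n x d ⟩
            r + k * d                        ≡⟨ cong (λ z → r + z * d) (m+[n∸m]≡n (≮⇒≥ k≮rq)) ⟨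
            r + (r * q + l) * d              ≡⟨ cong (λ z → r + (r * q + z) * d) (m≡m%n+[m/n]*n l m) ⟩
            r + (r * q + (j + t * m)) * d    ≡⟨ assemble r t j d q ⟩
            m * N + d * j                    ∎
            where open ≡-Reasoning

          v<j : v N < j
          v<j = ≰⇒> λ j≤v → x∉ (N , j , x≡ , j≤v)

          j≤dq : j ≤ d * q
          j≤dq = m<1+n⇒m≤n (m%n<n l m)

          N<N₀ : N < N₀
          -- From `N₀` on, `v N` is at least `d * q`, the largest possible `j`.
          N<N₀ = ≰⇒> λ N₀≤N → <⇒≱ (<-≤-trans v<j j≤dq) (subst (_≤ v N) v[N₀] (v-mono N₀≤N))

          i< : j ∸ suc (v N) < d * q ∸ v N
          i< = ∸-monoˡ-< (s≤s j≤dq) v<j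

      genus-Staircase : ∀ {S : Pred ℕ 0ℓ} → (∀ x → x ∈ S ⇔ x ∈ Staircase v) →
                        HasGenus S (Σ< d (_* q) + Σ< N₀ (λ N → d * q ∸ v N))
      genus-Staircase S⇔ = HasCardinality-resp
        (λ x → mk⇔
          (λ x∈ x∈S → [ (λ p → low-gap p (let N , j , eq , _ = Equivalence.to (S⇔ x) x∈S in N , j , eq))
                      , (λ p → high-gap p (Equivalence.to (S⇔ x) x∈S)) ] x∈)
          (λ x∉S → gap-cases (x∉S ∘ Equivalence.from (S⇔ x))))
        (HasCardinality-∪
          (λ { p (N , i , _ , _ , eq) → low-gap p (N , _ , eq) })
          (HasCardinality-DoubleImage low (_* q) d
            (λ r<d r′<d _ _ → low-injective r<d r′<d))
          (HasCardinality-DoubleImage high (λ N → d * q ∸ v N) N₀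
            (λ _ _ → high-injective)))

  -- Legendre sums

  module Legendre (d : ℕ) .{{_ : NonZero d}} where

    b : ℕ
    b = suc d

    -- The first `K` terms of Legendre's sum, which for prime `b` gives the exponent of `b` in N!.
    -- The count `K` makes the recursion structural.
    floorSum : ℕ → ℕ → ℕ
    floorSum zero    N = 0
    floorSum (suc K) N = N / b + floorSum K (N / b)

    -- Σ_{i≥1} ⌊N / bⁱ⌋, the terms with i > N being zero.
    v : ℕ → ℕ
    v N = floorSum N N

    floorSum-zero : ∀ K → floorSum K 0 ≡ 0
    floorSum-zero zero    = refl
    floorSum-zero (suc K) = floorSum-zero K

    -- As `b ≥ 2`, division strictly lowers a positive number, so each step of the recursion uses up
    -- at most one unit of `K`.
    /b-≤ : ∀ {N K} → N ≤ suc K → N / b ≤ K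
    /b-≤ {zero}      _  = z≤n
    /b-≤ {N@(suc _)} N≤ = m<1+n⇒m≤n (<-≤-trans (m/n<m N b (s≤s (>-nonZero⁻¹ d))) N≤)

    -- Lets different arguments share one `K`, which reduces inequalities for `v` to inductions on
    -- `floorSum` at a common `K`.
    floorSum-stable : ∀ {K L N} → N ≤ K → N ≤ L → floorSum K N ≡ floorSum L N
    floorSum-stable {K} {L} {zero} _ _ = trans (floorSum-zero K) (sym (floorSum-zero L))
    floorSum-stable {suc K} {suc L} {N@(suc _)} N≤K N≤L =
      cong (N / b +_) (floorSum-stable (/b-≤ N≤K) (/b-≤ N≤L))

    floorSum-mono : ∀ K {M N} → M ≤ N → floorSum K M ≤ floorSum K N
    floorSum-mono zero    _   = z≤n
    floorSum-mono (suc K) M≤N = +-mono-≤ (/-monoˡ-≤ b M≤N) (floorSum-mono K (/-monoˡ-≤ b M≤N))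

    /-superadditive : ∀ M N → M / b + N / b ≤ (M + N) / b
    /-superadditive M N = begin
      M / b + N / b                  ≡⟨ m*n/n≡m (M / b + N / b) b ⟨
      (M / b + N / b) * b / b        ≡⟨ cong (_/ b) (*-distribʳ-+ b (M / b) (N / b)) ⟩
      (M / b * b + N / b * b) / b    ≤⟨ /-monoˡ-≤ b (+-mono-≤ (m/n*n≤m M b) (m/n*n≤m N b)) ⟩
      (M + N) / b                    ∎
      where open ≤-Reasoning

    -- Floors are superadditive term by term; monotonicity bridges from `M / b + N / b` to the
    -- possibly larger `(M + N) / b`.
    floorSum-superadditive : ∀ K M N → floorSum K M + floorSum K N ≤ floorSum K (M + N)
    floorSum-superadditive zero    M N = z≤n
    floorSum-superadditive (suc K) M N = begin
      (M / b + floorSum K (M / b)) + (N / b + floorSum K (N / b))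
        ≡⟨ +-interchange (M / b) _ (N / b) _ ⟩
      (M / b + N / b) + (floorSum K (M / b) + floorSum K (N / b))
        ≤⟨ +-mono-≤ (/-superadditive M N) (≤-trans (floorSum-superadditive K (M / b) (N / b))
                                                   (floorSum-mono K (/-superadditive M N))) ⟩
      (M + N) / b + floorSum K ((M + N) / b)  ∎
      where open ≤-Reasoning

    v-mono : ∀ {M N} → M ≤ N → v M ≤ v N
    v-mono {M} {N} M≤N =
      subst (_≤ v N) (floorSum-stable M≤N ≤-refl) (floorSum-mono N M≤N)

    -- This is what closes `Staircase v` under addition.
    v-superadditive : ∀ M N → v M + v N ≤ v (M + N)
    v-superadditive M N = subst (_≤ v (M + N))
      (cong₂ _+_ (floorSum-stable (m≤m+n M N) ≤-refl) (floorSum-stable (m≤n+m N M) ≤-refl))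
      (floorSum-superadditive (M + N) M N)

    v-unfold : ∀ N → v N ≡ N / b + v (N / b)
    v-unfold zero      = refl
    v-unfold N@(suc _) = cong (N / b +_)
      (floorSum-stable (/b-≤ {N} ≤-refl) ≤-refl)

    -- Appending a base-`b` digit to `M`: the first floor is `M`, and the later floors are those of
    -- `M`.
    v-digit : ∀ M {r} → r < b → v (M * b + r) ≡ M + v M
    v-digit M {r} r<b = trans (v-unfold (M * b + r)) (cong (λ z → z + v z) quot)
      where
      quot : (M * b + r) / b ≡ M
      quot = begin
        (M * b + r) / b      ≡⟨ +-distrib-/-∣ˡ r (divides M refl) ⟩
        M * b / b + r / b    ≡⟨ cong₂ _+_ (m*n/n≡m M b) (m<n⇒m/n≡0 r<b) ⟩
        M + 0                ≡⟨ +-identityʳ M ⟩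
        M                    ∎
        where open ≡-Reasoning

    v-* : ∀ M → v (b * M) ≡ M + v M
    v-* M = trans (cong v (trans (*-comm b M) (sym (+-identityʳ (M * b))))) (v-digit M z<s)

    v-small : ∀ {r} → r < b → v r ≡ 0
    v-small = v-digit 0

    -- `v (b ^ i)` is the repunit 1 + b + ... + bⁱ⁻¹, that is, (bⁱ - 1) / (b - 1).
    v-^ : ∀ i → b ^ i ≡ suc (d * v (b ^ i))
    v-^ zero    = cong suc (sym (trans (cong (d *_) (v-small (s≤s (>-nonZero⁻¹ d)))) (*-zeroʳ d)))
    v-^ (suc i) = begin
      b * b ^ i                            ≡⟨⟩
      b ^ i + d * b ^ i                    ≡⟨ cong (_+ d * b ^ i) (v-^ i) ⟩
      suc (d * v (b ^ i)) + d * b ^ i      ≡⟨ collect d (v (b ^ i)) (b ^ i) ⟩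
      suc (d * (b ^ i + v (b ^ i)))        ≡⟨ cong (λ z → suc (d * z)) (v-* (b ^ i)) ⟨
      suc (d * v (b * b ^ i))              ∎
      where
      open ≡-Reasoning
      collect : ∀ d u p → suc (d * u) + d * p ≡ suc (d * (p + u))
      collect = solve-∀

    -- b² − 1
    A : ℕ
    A = d * b + d

    -- With `m = (b + 1) * b ^ n ∸ 1` this says that `v` equals m - 1 at bⁿ(b² - 1); each further
    -- factor `b` is handled by `v-*`.
    v-threshold : ∀ n → v (b ^ n * A) + 2 ≡ (b + 1) * b ^ n
    v-threshold zero = begin
      v (1 * A) + 2      ≡⟨ cong (λ z → v z + 2) (*-identityˡ A) ⟩
      -- In base `b` the number `A` has the two digits `d`, `d`.
      v A + 2            ≡⟨ cong (_+ 2) (v-digit d ≤-refl) ⟩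
      d + v d + 2        ≡⟨ cong (λ z → d + z + 2) (v-small ≤-refl) ⟩
      d + 0 + 2          ≡⟨ arrange d ⟩
      (b + 1) * 1        ∎
      where
      open ≡-Reasoning
      arrange : ∀ d → d + 0 + 2 ≡ (suc d + 1) * 1
      arrange = solve-∀
    v-threshold (suc n) = begin
      v (b * b ^ n * A) + 2              ≡⟨ cong (λ z → v z + 2) (*-assoc b (b ^ n) A) ⟩
      v (b * (b ^ n * A)) + 2            ≡⟨ cong (_+ 2) (v-* (b ^ n * A)) ⟩
      b ^ n * A + v (b ^ n * A) + 2      ≡⟨ +-assoc (b ^ n * A) _ 2 ⟩
      b ^ n * A + (v (b ^ n * A) + 2)    ≡⟨ cong (b ^ n * A +_) (v-threshold n) ⟩
      b ^ n * A + (b + 1) * b ^ n        ≡⟨ arrange d (b ^ n) ⟩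
      (b + 1) * (b * b ^ n)              ∎
      where
      open ≡-Reasoning
      arrange : ∀ d p → p * (d * suc d + d) + (suc d + 1) * p ≡ (suc d + 1) * (suc d * p)
      arrange = solve-∀

    -- Sums of `v` over initial segments

    Σv-block : ∀ M {r} → r ≤ b → Σ< r (λ i → v (M * b + i)) ≡ r * (M + v M)
    Σv-block M {r} r≤b = trans
      (Σ<-cong r (λ i<r → v-digit M (<-≤-trans i<r r≤b)))
      (Σ<-const r (M + v M))

    -- The segment is cut into `M` blocks of length `b`, on each of which `v` is constant.
    Σv-* : ∀ M → Σ< (M * b) v ≡ b * Σ< M (λ i → i + v i)
    Σv-* zero    = sym (*-zeroʳ b)
    Σv-* (suc M) = begin
      Σ< (b + M * b) v                                   ≡⟨ cong (λ z → Σ< z v) (+-comm b (M * b)) ⟩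
      Σ< (M * b + b) v                                   ≡⟨ Σ<-split b (M * b) v ⟩
      Σ< b (λ i → v (M * b + i)) + Σ< (M * b) v          ≡⟨ cong₂ _+_ (Σv-block M ≤-refl) (Σv-* M) ⟩
      b * (M + v M) + b * Σ< M (λ i → i + v i)           ≡⟨ *-distribˡ-+ b (M + v M) _ ⟨
      b * (M + v M + Σ< M (λ i → i + v i))               ∎
      where open ≡-Reasoning

    2Σv-* : ∀ M → 2 * Σ< (M * b) v + b * M ≡ b * (M * M) + b * (2 * Σ< M v)
    2Σv-* M = begin
      2 * Σ< (M * b) v + b * M                             ≡⟨ cong (λ z → 2 * z + b * M) (Σv-* M) ⟩
      2 * (b * Σ< M (λ i → i + v i)) + b * M               ≡⟨ cong (λ z → 2 * (b * z) + b * M) (Σ<-+ M (λ i → i) v) ⟩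
      2 * (b * (Σ< M (λ i → i) + Σ< M v)) + b * M          ≡⟨ isolate b M (Σ< M (λ i → i)) (Σ< M v) ⟩
      b * (2 * Σ< M (λ i → i) + M) + b * (2 * Σ< M v)      ≡⟨ cong (λ z → b * z + b * (2 * Σ< M v)) (Σ<-id M) ⟩
      b * (M * M) + b * (2 * Σ< M v)                       ∎
      where
      open ≡-Reasoning
      isolate : ∀ b M x y → 2 * (b * (x + y)) + b * M ≡ b * (2 * x + M) + b * (2 * y)
      isolate = solve-∀

    2Σv-A : 2 * Σ< A v + 2 * A + d ≡ A * (d + 2)
    2Σv-A = begin
      2 * Σ< A v + 2 * A + d
        -- Since `A = d * b + d`, the segment ends in a partial block of length `d`.
        ≡⟨ cong (λ z → 2 * z + 2 * A + d) (Σ<-split d (d * b) v) ⟩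
      2 * (Σ< d (λ i → v (d * b + i)) + Σ< (d * b) v) + 2 * A + d
        ≡⟨ cong (λ z → 2 * (z + Σ< (d * b) v) + 2 * A + d) (Σv-block d (n≤1+n d)) ⟩
      2 * (d * (d + v d) + Σ< (d * b) v) + 2 * A + d
        ≡⟨ cong (λ z → 2 * (d * (d + z) + Σ< (d * b) v) + 2 * A + d) (v-small ≤-refl) ⟩
      2 * (d * (d + 0) + Σ< (d * b) v) + 2 * A + d
        -- The term `b * d` completes the left side of `2Σv-*` at `M = d`; `3 * d * d + 4 * d` is
        -- the remainder.
        ≡⟨ isolate d (Σ< (d * b) v) ⟩
      2 * Σ< (d * b) v + b * d + (3 * d * d + 4 * d)
        ≡⟨ cong (_+ (3 * d * d + 4 * d)) (2Σv-* d) ⟩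
      b * (d * d) + b * (2 * Σ< d v) + (3 * d * d + 4 * d)
        ≡⟨ cong (λ z → b * (d * d) + b * (2 * z) + (3 * d * d + 4 * d)) Σv-small ⟩
      b * (d * d) + b * (2 * 0) + (3 * d * d + 4 * d)
        ≡⟨ collect d ⟩
      A * (d + 2) ∎
      where
      open ≡-Reasoning
      Σv-small : Σ< d v ≡ 0
      Σv-small = trans (Σ<-cong d (λ i<d → v-small (m≤n⇒m≤1+n i<d))) (trans (Σ<-const d 0) (*-zeroʳ d))
      isolate : ∀ d s → 2 * (d * (d + 0) + s) + 2 * (d * suc d + d) + d
                        ≡ 2 * s + suc d * d + (3 * d * d + 4 * d)
      isolate = solve-∀
      collect : ∀ d → suc d * (d * d) + suc d * (2 * 0) + (3 * d * d + 4 * d)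
                      ≡ (d * suc d + d) * (d + 2)
      collect = solve-∀

    -- Each use of `2Σv-*` adds `A * b ^ (n + 1)` on the left, whence the coefficient linear in `n`.
    -- The right side keeps its form because A + d + 2 = b (d + 2).
    2Σv-^*A : ∀ n → 2 * Σ< (b ^ n * A) v + (n * A + 2 * A + d) * b ^ n
                    ≡ A * (d + 2) * (b ^ n * b ^ n)
    2Σv-^*A zero = begin
      2 * Σ< (1 * A) v + (0 * A + 2 * A + d) * 1    ≡⟨ cong (λ z → 2 * Σ< z v + (0 * A + 2 * A + d) * 1) (*-identityˡ A) ⟩
      2 * Σ< A v + (0 * A + 2 * A + d) * 1          ≡⟨ arrange (Σ< A v) A d ⟩
      2 * Σ< A v + 2 * A + d                        ≡⟨ 2Σv-A ⟩
      A * (d + 2)                                   ≡⟨ *-identityʳ _ ⟨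
      A * (d + 2) * 1                               ∎
      where
      open ≡-Reasoning
      arrange : ∀ s a d → 2 * s + (0 * a + 2 * a + d) * 1 ≡ 2 * s + 2 * a + d
      arrange = solve-∀
    2Σv-^*A (suc n) = begin
      2 * Σ< (b * p * A) v + (suc n * A + 2 * A + d) * (b * p)
        ≡⟨ cong (λ z → 2 * Σ< z v + (suc n * A + 2 * A + d) * (b * p))
             (trans (*-assoc b p A) (*-comm b (p * A))) ⟩
      2 * Σ< (p * A * b) v + (suc n * A + 2 * A + d) * (b * p)
        ≡⟨ isolate (Σ< (p * A * b) v) n A d b p ⟩
      (2 * Σ< (p * A * b) v + b * (p * A)) + (n * A + 2 * A + d) * (b * p)
        ≡⟨ cong (_+ (n * A + 2 * A + d) * (b * p)) (2Σv-* (p * A)) ⟩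
      b * (p * A * (p * A)) + b * (2 * Σ< (p * A) v) + (n * A + 2 * A + d) * (b * p)
        ≡⟨ factor (Σ< (p * A) v) n A d b p ⟩
      b * (p * A * (p * A)) + b * (2 * Σ< (p * A) v + (n * A + 2 * A + d) * p)
        ≡⟨ cong (λ z → b * (p * A * (p * A)) + b * z) (2Σv-^*A n) ⟩
      b * (p * A * (p * A)) + b * (A * (d + 2) * (p * p))
        ≡⟨ collect d p ⟩
      A * (d + 2) * (b * p * (b * p)) ∎
      where
      open ≡-Reasoning
      p : ℕ
      p = b ^ n
      isolate : ∀ s n a d b p → 2 * s + (suc n * a + 2 * a + d) * (b * p)
                                ≡ (2 * s + b * (p * a)) + (n * a + 2 * a + d) * (b * p)
      isolate = solve-∀
      factor : ∀ s n a d b p → b * (p * a * (p * a)) + b * (2 * s) + (n * a + 2 * a + d) * (b * p)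
                               ≡ b * (p * a * (p * a)) + b * (2 * s + (n * a + 2 * a + d) * p)
      factor = solve-∀
      collect : ∀ d p → suc d * (p * (d * suc d + d) * (p * (d * suc d + d)))
                          + suc d * ((d * suc d + d) * (d + 2) * (p * p))
                        ≡ (d * suc d + d) * (d + 2) * (suc d * p * (suc d * p))
      collect = solve-∀

    -- The semigroup T b n

    S : ℕ → ℕ
    S k = (b + 1) * b ^ k ∸ 1

    suc-S : ∀ k → suc (S k) ≡ (b + 1) * b ^ k
    suc-S k = m+[n∸m]≡n (*-mono-≤ (m≤n+m 1 b) (m^n>0 b k))

    -- The exchange relation: `b` copies of one generator and one `d` make the next generator.
    S-suc : ∀ k → S (suc k) ≡ b * S k + d
    S-suc k = suc-injective (begin
      suc (S (suc k))        ≡⟨ suc-S (suc k) ⟩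
      (b + 1) * (b * b ^ k)  ≡⟨ swap (b + 1) b (b ^ k) ⟩
      b * ((b + 1) * b ^ k)  ≡⟨ cong (b *_) (suc-S k) ⟨
      b * suc (S k)          ≡⟨ arrange d (S k) ⟩
      suc (b * S k + d)      ∎)
      where
      open ≡-Reasoning
      swap : ∀ x y z → x * (y * z) ≡ y * (x * z)
      swap = solve-∀
      arrange : ∀ d s → suc d * suc s ≡ suc (suc d * s + d)
      arrange = solve-∀

    -- From (S n + 1) bⁱ - 1 = S n · bⁱ + (bⁱ - 1). It places each generator on the boundary
    -- `j = v N` of the staircase, at `N = b ^ i`.
    S-+ : ∀ n i → S (n + i) ≡ S n * b ^ i + d * v (b ^ i)
    S-+ n i = suc-injective (begin
      suc (S (n + i))                       ≡⟨ suc-S (n + i) ⟩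
      (b + 1) * b ^ (n + i)                 ≡⟨ cong ((b + 1) *_) (^-distribˡ-+-* b n i) ⟩
      (b + 1) * (b ^ n * b ^ i)             ≡⟨ *-assoc (b + 1) (b ^ n) (b ^ i) ⟨
      (b + 1) * b ^ n * b ^ i               ≡⟨ cong (_* b ^ i) (suc-S n) ⟨
      b ^ i + S n * b ^ i                   ≡⟨ cong (_+ S n * b ^ i) (v-^ i) ⟩
      suc (d * v (b ^ i)) + S n * b ^ i     ≡⟨ cong suc (+-comm (d * v (b ^ i)) _) ⟩
      suc (S n * b ^ i + d * v (b ^ i))     ∎)
      where open ≡-Reasoning

    module _ (n : ℕ) where

      -- The quotient (m - 1) / d without division: (b + 1) bⁿ - 2 = d bⁿ + 2 (bⁿ - 1), and `v-^`
      -- divides bⁿ - 1 by `d`.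
      q : ℕ
      q = b ^ n + 2 * v (b ^ n)

      S-q : S n ≡ suc (d * q)
      S-q = suc-injective (begin
        suc (S n)                              ≡⟨ suc-S n ⟩
        (b + 1) * b ^ n                        ≡⟨ split d (b ^ n) ⟩
        d * b ^ n + 2 * b ^ n                  ≡⟨ cong (λ z → d * b ^ n + 2 * z) (v-^ n) ⟩
        d * b ^ n + 2 * suc (d * v (b ^ n))    ≡⟨ collect d (b ^ n) (v (b ^ n)) ⟩
        suc (suc (d * q))                      ∎)
        where
        open ≡-Reasoning
        split : ∀ d p → (suc d + 1) * p ≡ d * p + 2 * p
        split = solve-∀
        collect : ∀ d p u → d * p + 2 * suc (d * u) ≡ suc (suc (d * (p + 2 * u)))
        collect = solve-∀

      T-* : ∀ k {x} → x ∈ T b n → k * x ∈ T b n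
      T-* zero    x∈ = zero
      T-* (suc k) x∈ = add x∈ (T-* k x∈)

      S∈T : ∀ i → S (n + i) ∈ T b n
      S∈T i = gen (i , refl)

      -- Trading b copies of S (n + i) for one of S (n + suc i) adds d.  If j ≤ N / b, trade
      -- j times; otherwise trade all N / b times and continue one level up.
      staircase∈T′ : ∀ K i N j → N ≤ K → j ≤ floorSum K N → S (n + i) * N + d * j ∈ T b n
      staircase∈T′ zero i zero zero _ _ = subst (_∈ T b n) (sym (cong₂ _+_ (*-zeroʳ (S (n + i))) (*-zeroʳ d))) zero
      staircase∈T′ (suc K) i N j N≤ j≤ with j ≤? N / b
      ... | yes j≤q = subst (_∈ T b n) eq
              (add (T-* (N ∸ b * j) (S∈T i)) (T-* j (S∈T (suc i))))
        where
        open ≡-Reasoning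
        bj≤N : b * j ≤ N
        bj≤N = ≤-trans (*-monoʳ-≤ b j≤q) (subst (_≤ N) (*-comm (N / b) b) (m/n*n≤m N b))
        arrange : ∀ x s j d → x * s + j * (suc d * s + d) ≡ s * (x + suc d * j) + d * j
        arrange = solve-∀
        eq : (N ∸ b * j) * S (n + i) + j * S (n + suc i) ≡ S (n + i) * N + d * j
        eq = begin
          (N ∸ b * j) * S (n + i) + j * S (n + suc i)
            ≡⟨ cong (λ z → (N ∸ b * j) * S (n + i) + j * z) (trans (cong S (+-suc n i)) (S-suc (n + i))) ⟩
          (N ∸ b * j) * S (n + i) + j * (b * S (n + i) + d)
            ≡⟨ arrange (N ∸ b * j) (S (n + i)) j d ⟩
          S (n + i) * (N ∸ b * j + b * j) + d * j
            ≡⟨ cong (λ z → S (n + i) * z + d * j) (m∸n+n≡m bj≤N) ⟩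
          S (n + i) * N + d * j ∎
      -- The `N % b` copies that do not fill a trade stay at level `i`; the `N / b` trades account
      -- for the first term of `floorSum`, so the rest of `j` is within the bound of the next level.
      ... | no j≰q = subst (_∈ T b n) eq
              (add (T-* (N % b) (S∈T i))
                   (staircase∈T′ K (suc i) (N / b) (j ∸ N / b)
                     (/b-≤ N≤) (m≤n+o⇒m∸n≤o j (N / b) j≤)))
        where
        open ≡-Reasoning
        arrange : ∀ r s Q j d → r * s + ((suc d * s + d) * Q + d * j) ≡ s * (r + Q * suc d) + d * (Q + j)
        arrange = solve-∀
        eq : N % b * S (n + i) + (S (n + suc i) * (N / b) + d * (j ∸ N / b)) ≡ S (n + i) * N + d * j
        eq = begin
          N % b * S (n + i) + (S (n + suc i) * (N / b) + d * (j ∸ N / b))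
            ≡⟨ cong (λ z → N % b * S (n + i) + (z * (N / b) + d * (j ∸ N / b)))
                 (trans (cong S (+-suc n i)) (S-suc (n + i))) ⟩
          N % b * S (n + i) + ((b * S (n + i) + d) * (N / b) + d * (j ∸ N / b))
            ≡⟨ arrange (N % b) (S (n + i)) (N / b) (j ∸ N / b) d ⟩
          S (n + i) * (N % b + N / b * b) + d * (N / b + (j ∸ N / b))
            ≡⟨ cong₂ (λ x y → S (n + i) * x + d * y)
                 (sym (m≡m%n+[m/n]*n N b)) (m+[n∸m]≡n (<⇒≤ (≰⇒> j≰q))) ⟩
          S (n + i) * N + d * j ∎

      N₀ : ℕ
      N₀ = b ^ n * A

      v[N₀] : v N₀ ≡ d * q
      v[N₀] = +-cancelʳ-≡ 2 _ _ (begin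
        v N₀ + 2           ≡⟨ v-threshold n ⟩
        (b + 1) * b ^ n    ≡⟨ suc-S n ⟨
        suc (S n)          ≡⟨ cong suc S-q ⟩
        2 + d * q          ≡⟨ +-comm 2 (d * q) ⟩
        d * q + 2          ∎)
        where open ≡-Reasoning

      open Gaps d q using (m; Staircase; genus-Staircase)

      staircase⇒T : ∀ {x} → x ∈ Staircase v → x ∈ T b n
      staircase⇒T (N , j , refl , j≤v) =
        subst (λ z → z * N + d * j ∈ T b n) (trans (cong S (+-identityʳ n)) S-q)
          (staircase∈T′ N 0 N j ≤-refl j≤v)

      -- Coefficients add, so superadditivity of `v` handles sums; generators come from `S-+`.
      T⇒staircase : ∀ {x} → x ∈ T b n → x ∈ Staircase v
      T⇒staircase (gen (i , refl)) =
        b ^ i , v (b ^ i) , trans (S-+ n i) (cong (λ z → z * b ^ i + d * v (b ^ i)) S-q) , ≤-refl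
      T⇒staircase zero = 0 , 0 , sym (cong₂ _+_ (*-zeroʳ m) (*-zeroʳ d)) , z≤n
      T⇒staircase (add x∈ y∈) with T⇒staircase x∈ | T⇒staircase y∈
      ... | M , i , refl , i≤ | N , j , refl , j≤ =
        M + N , i + j , arrange m d M N i j , ≤-trans (+-mono-≤ i≤ j≤) (v-superadditive M N)
        where
        arrange : ∀ m d M N i j → m * M + d * i + (m * N + d * j) ≡ m * (M + N) + d * (i + j)
        arrange = solve-∀

      -- Computation of the genus of `T b n`

      genus : ℕ
      genus = Σ< d (_* q) + Σ< N₀ (λ N → d * q ∸ v N)

      genus-T : HasGenus (T b n) genus
      genus-T = genus-Staircase v v-mono N₀ v[N₀] (λ x → mk⇔ T⇒staircase staircase⇒T)

      -- For `N < N₀` monotonicity gives `v N ≤ v N₀ = d * q`, so no subtraction is truncated.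
      Σ-complement : Σ< N₀ (λ N → d * q ∸ v N) + Σ< N₀ v ≡ N₀ * (d * q)
      Σ-complement = begin
        Σ< N₀ (λ N → d * q ∸ v N) + Σ< N₀ v    ≡⟨ Σ<-+ N₀ (λ N → d * q ∸ v N) v ⟨
        Σ< N₀ (λ N → d * q ∸ v N + v N)        ≡⟨ Σ<-cong N₀ (λ {N} N<N₀ →
                                                    m∸n+n≡m (subst (v N ≤_) v[N₀] (v-mono (<⇒≤ N<N₀)))) ⟩
        Σ< N₀ (λ _ → d * q)                    ≡⟨ Σ<-const N₀ (d * q) ⟩
        N₀ * (d * q)                           ∎
        where open ≡-Reasoning

      -- The genus formula with the negative terms moved to the left.
      genus-formula : 2 * genus + (A + 2) * b ^ n + 2 * d
                      ≡ (d + 2) * A * (b ^ n * b ^ n) + n * A * b ^ n + 2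
      -- In the cancelled term, `2 * V` and `w` complete the left sides of `Σ-complement` and `2G₁`;
      -- the rest lets `w` enter only through `w + 2`, which is `(d + 2) * p`.
      genus-formula = +-cancelʳ-≡ (2 * V + w + 3 * (p * A) + p * d) _ _ (begin
        2 * (G₁ + G₂) + (A + 2) * p + 2 * d + (2 * V + w + 3 * (p * A) + p * d)
          ≡⟨ gatherˡ G₁ G₂ V w p A d ⟩
        (2 * G₁ + w) + 2 * (G₂ + V) + (4 * (p * A) + 2 * p + 2 * d + p * d)
          ≡⟨ cong₂ (λ x y → x + 2 * y + (4 * (p * A) + 2 * p + 2 * d + p * d)) 2G₁ Σ-complement ⟩
        w * d + 2 * (p * A * w) + (4 * (p * A) + 2 * p + 2 * d + p * d)
          ≡⟨ factor w p A d ⟩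
        (w + 2) * (d + 2 * (p * A)) + (d + 2) * p
          ≡⟨ cong (λ z → z * (d + 2 * (p * A)) + (d + 2) * p) w+2 ⟩
        (d + 2) * p * (d + 2 * (p * A)) + (d + 2) * p
          -- Uses A = d (d + 2). Of the two equal leading terms, one stays and the other is
          -- exchanged for `V` by `2Σv-^*A`.
          ≡⟨ expand p d ⟩
        (d + 2) * A * (p * p) + A * (d + 2) * (p * p) + (d + 2) * p + p * A
          ≡⟨ cong₂ (λ x y → (d + 2) * A * (p * p) + x + y + p * A) (2Σv-^*A n) w+2 ⟨
        (d + 2) * A * (p * p) + (2 * V + (n * A + 2 * A + d) * p) + (w + 2) + p * A
          ≡⟨ gatherʳ n V w p A d ⟩
        (d + 2) * A * (p * p) + n * A * p + 2 + (2 * V + w + 3 * (p * A) + p * d) ∎)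
        where
        open ≡-Reasoning
        p w G₁ G₂ V : ℕ
        p  = b ^ n
        w  = d * q
        G₁ = Σ< d (_* q)
        G₂ = Σ< N₀ (λ N → d * q ∸ v N)
        V  = Σ< N₀ v
        2G₁ : 2 * G₁ + w ≡ w * d
        2G₁ = trans (Σ<-linear d q) (swap d q)
          where
          swap : ∀ d q → d * d * q ≡ d * q * d
          swap = solve-∀
        w+2 : w + 2 ≡ (d + 2) * p
        w+2 = trans (cong (_+ 2) (sym v[N₀])) (trans (v-threshold n) (cong (_* p) (sym (+-suc d 1))))
        gatherˡ : ∀ g h s w p a d → 2 * (g + h) + (a + 2) * p + 2 * d + (2 * s + w + 3 * (p * a) + p * d)
                  ≡ (2 * g + w) + 2 * (h + s) + (4 * (p * a) + 2 * p + 2 * d + p * d)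
        gatherˡ = solve-∀
        factor : ∀ w p a d → w * d + 2 * (p * a * w) + (4 * (p * a) + 2 * p + 2 * d + p * d)
                 ≡ (w + 2) * (d + 2 * (p * a)) + (d + 2) * p
        factor = solve-∀
        expand : ∀ p d → (d + 2) * p * (d + 2 * (p * (d * suc d + d))) + (d + 2) * p
                 ≡ (d + 2) * (d * suc d + d) * (p * p) + (d * suc d + d) * (d + 2) * (p * p)
                   + (d + 2) * p + p * (d * suc d + d)
        expand = solve-∀
        gatherʳ : ∀ n s w p a d → (d + 2) * a * (p * p) + (2 * s + (n * a + 2 * a + d) * p) + (w + 2) + p * a
                  ≡ (d + 2) * a * (p * p) + n * a * p + 2 + (2 * s + w + 3 * (p * a) + p * d)
        gatherʳ = solve-∀

-- Passage to integers and rationals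

import Data.Integer.Properties as ℤ
import Data.Integer.Tactic.RingSolver as ℤ-Solver
import Data.Nat as ℕ
import Data.Nat.Properties as ℕₚ
import Data.Rational.Properties as ℚ
import Data.Rational.Unnormalised as ℚᵘ
open import Data.Integer using (+_; _+_; _-_; _*_; _^_)
open import Data.Nat using (ℕ; _≤_)
open import Data.Product using (_×_; ∃-syntax; _,_)
open import Data.Rational using (_/_)
open import Relation.Binary.PropositionalEquality
  using (_≡_; refl; sym; trans; cong; cong₂; module ≡-Reasoning)

pos-^ : ∀ m n → + (m ℕ.^ n) ≡ (+ m) ^ n
pos-^ m ℕ.zero    = refl
pos-^ m (ℕ.suc n) = trans (ℤ.pos-* m (m ℕ.^ n)) (cong (+ m *_) (pos-^ m n))

-- For unnormalised fractions equality is cross-multiplication, so `x / 2` need not be reduced.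
-- `mkℚᵘ` takes the denominator minus one: 0 and 1 stand for 1 and 2.
half : ∀ g x → + 2 * + g ≡ x → (+ g) / 1 ≡ x / 2
half g x eq = ℚ.fromℚᵘ-cong {ℚᵘ.mkℚᵘ (+ g) 0} {ℚᵘ.mkℚᵘ x 1}
  (ℚᵘ.*≡* (trans (ℤ.*-comm (+ g) (+ 2)) (trans eq (sym (ℤ.*-identityʳ x)))))

module _ (d n : ℕ) .{{_ : ℕ.NonZero d}} where

  open NumericalSemigroup.Legendre d using (b; A; genus; genus-formula)

  private
    g p : ℕ
    g = genus n
    p = b ℕ.^ n

  genus-formula-ℤ :
    + 2 * + g ≡ ((+ b) ^ 3 + (+ b) ^ 2 - (+ b) - (+ 1)) * (+ b) ^ (2 ℕ.* n)
                + (((+ n) - (+ 1)) * ((+ b) ^ 2 - (+ 1)) - (+ 2)) * (+ b) ^ n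
                - (+ 2) * (+ b) + (+ 4)
  genus-formula-ℤ = begin
    + 2 * + g
      ≡⟨ move (+ 2 * + g) ((+ A + + 2) * + p) (+ 2 * + d) ⟩
    (+ 2 * + g + (+ A + + 2) * + p + + 2 * + d) - (+ A + + 2) * + p - + 2 * + d
      ≡⟨ cong (λ z → z - (+ A + + 2) * + p - + 2 * + d) formula ⟩
    ((+ d + + 2) * + A * (+ p * + p) + + n * + A * + p + + 2) - (+ A + + 2) * + p - + 2 * + d
      ≡⟨ cong (λ a → ((+ d + + 2) * a * (+ p * + p) + + n * a * + p + + 2) - (a + + 2) * + p - + 2 * + d)
           (cong (_+ + d) (ℤ.pos-* d b)) ⟩
    ((+ d + + 2) * (+ d * (+ 1 + + d) + + d) * (+ p * + p) + + n * (+ d * (+ 1 + + d) + + d) * + p + + 2)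
      - ((+ d * (+ 1 + + d) + + d) + + 2) * + p - + 2 * + d
      ≡⟨ polynomial (+ d) (+ n) (+ p) ⟩
    -- Powers appear as the products to which `_^_` unfolds, and `B` is `+ 1 + + d` by computation,
    -- so this matches `polynomial`.
    (B * (B * (B * + 1)) + B * (B * + 1) - B - + 1) * (+ p * (+ p * + 1))
      + ((+ n - + 1) * (B * (B * + 1) - + 1) - + 2) * + p - + 2 * B + + 4
      ≡⟨ cong₂ (λ x y → (B ^ 3 + B ^ 2 - B - + 1) * x + ((+ n - + 1) * (B ^ 2 - + 1) - + 2) * y - + 2 * B + + 4)
           p² (pos-^ b n) ⟩
    (B ^ 3 + B ^ 2 - B - + 1) * B ^ (2 ℕ.* n)
      + ((+ n - + 1) * (B ^ 2 - + 1) - + 2) * B ^ n - + 2 * B + + 4 ∎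
    where
    open ≡-Reasoning
    B = + b

    p² : (+ p) ^ 2 ≡ B ^ (2 ℕ.* n)
    p² = begin
      (+ p) ^ 2        ≡⟨ pos-^ p 2 ⟨
      + (p ℕ.^ 2)      ≡⟨ cong +_ (ℕₚ.^-*-assoc b n 2) ⟩
      + (b ℕ.^ (n ℕ.* 2)) ≡⟨ cong (λ k → + (b ℕ.^ k)) (ℕₚ.*-comm n 2) ⟩
      + (b ℕ.^ (2 ℕ.* n)) ≡⟨ pos-^ b (2 ℕ.* n) ⟩
      B ^ (2 ℕ.* n)    ∎

    move : ∀ x y z → x ≡ (x + y + z) - y - z
    move = ℤ-Solver.solve-∀

    formula : + 2 * + g + (+ A + + 2) * + p + + 2 * + d
              ≡ (+ d + + 2) * + A * (+ p * + p) + + n * + A * + p + + 2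
    formula = begin
      + 2 * + g + (+ A + + 2) * + p + + 2 * + d
        ≡⟨ cong₂ _+_ (cong₂ _+_ (ℤ.pos-* 2 g) (ℤ.pos-* (A ℕ.+ 2) p)) (ℤ.pos-* 2 d) ⟨
      + (2 ℕ.* g ℕ.+ (A ℕ.+ 2) ℕ.* p ℕ.+ 2 ℕ.* d)
        ≡⟨ cong +_ (genus-formula n) ⟩
      + ((d ℕ.+ 2) ℕ.* A ℕ.* (p ℕ.* p) ℕ.+ n ℕ.* A ℕ.* p ℕ.+ 2)
        ≡⟨ cong₂ (λ x y → x + y + + 2)
             (trans (ℤ.pos-* ((d ℕ.+ 2) ℕ.* A) (p ℕ.* p)) (cong₂ _*_ (ℤ.pos-* (d ℕ.+ 2) A) (ℤ.pos-* p p)))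
             (trans (ℤ.pos-* (n ℕ.* A) p) (cong (_* + p) (ℤ.pos-* n A))) ⟩
      (+ d + + 2) * + A * (+ p * + p) + + n * + A * + p + + 2 ∎

    polynomial : ∀ d n p →
      ((d + + 2) * (d * (+ 1 + d) + d) * (p * p) + n * (d * (+ 1 + d) + d) * p + + 2)
        - ((d * (+ 1 + d) + d) + + 2) * p - + 2 * d
      ≡ ((+ 1 + d) * ((+ 1 + d) * ((+ 1 + d) * + 1)) + (+ 1 + d) * ((+ 1 + d) * + 1) - (+ 1 + d) - + 1) * (p * (p * + 1))
        + ((n - + 1) * ((+ 1 + d) * ((+ 1 + d) * + 1) - + 1) - + 2) * p - + 2 * (+ 1 + d) + + 4
    polynomial = ℤ-Solver.solve-∀

mainTheorem2 : (b n : ℕ) → 2 ≤ b →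
    ∃[ g ] HasGenus (T b n) g ×
    (+ g) / 1 ≡
    (((+ b) ^ 3 + (+ b) ^ 2 - (+ b) - (+ 1)) * (+ b) ^ (2 Data.Nat.* n)
    + (((+ n) - (+ 1)) * ((+ b) ^ 2 - (+ 1)) - (+ 2)) * (+ b) ^ n
    - (+ 2) * (+ b) + (+ 4)) / 2
-- Matching `d = b − 1` as a successor supplies the instance `NonZero d`.
mainTheorem2 (ℕ.suc d@(ℕ.suc _)) n _ =
  genus n , genus-T n , half (genus n) _ (genus-formula-ℤ d n)
  where open NumericalSemigroup.Legendre d using (genus; genus-T)
mainTheorem2 (ℕ.suc ℕ.zero) n (ℕ.s≤s ())
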